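{- If the maximal terminal unit-band suffix of the Havel--Hakimi trajectory of a graphic sequence is nonempty and begins with pivot $D_*$, then its total defect is at most \[ \frac32-\frac1{D_*}-\frac1{D_*+1}<\frac32 . \] If the suffix is empty, its total defect is zero. In particular, every terminal unit-band suffix contributes at most $3/2$.
   Context: A finite sequence of nonnegative integers is graphic if it is the degree sequence of a finite simple graph. For a nonincreasing graphic sequence $\mathbf d=(d_1,\ldots,d_t)$ with $d_1=D>0$, its Havel--Hakimi reduction is obtained by deleting $d_1=D$ (the pivot), subtracting one from each of $d_2,\ldots,d_{D+1}$ (the selected entries, positive by graphicality), and reordering in nonincreasing order. Repeating while the largest term is positive gives the trajectory $\mathbf d^{(0)},\ldots,\mathbf d^{(s)}$ ending at an all-zero sequence; step $j$ ($0\le j<s$) is the passage from $\mathbf d^{(j)}$ to $\mathbf d^{(j+1)}$, with pivot $D_j=d^{(j)}_1$. The defect of step $j$ is \[ \delta_j=\sum_{i=2}^{D_j+1}\frac{1}{d_i^{(j)}(d_i^{(j)}+1)}-\frac{1}{D_j+1}, \] which equals $\operatorname{CW}(\mathbf d^{(j+1)})-\operatorname{CW}(\mathbf d^{(j)})$, where $\operatorname{CW}(\mathbf d)=\sum_i\frac1{d_i+1}$. A step with pivot $D$ is a unit-band step if every selected degree (before subtraction) belongs to $\{D,D-1\}$. The (maximal) terminal unit-band suffix is the part of the trajectory beginning with its first unit-band step and ending with the all-zero sequence; it is empty if there is no unit-band step. Its total defect is the sum of $\delta_j$ over its steps. -}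

module Defs where

open import Data.Fin.Base using (Fin)
open import Data.Fin.Subset using (Subset; _∈_; _∉_; ∣_∣)
open import Data.Integer.Base using (+_)
open import Data.List.Base
  using (List; []; _∷_; _++_; map; foldr; take; drop; length; tabulate; dropWhile)
open import Data.List.Relation.Binary.Permutation.Propositional using (_↭_)
open import Data.List.Relation.Unary.All using (All; all?)
open import Data.List.Relation.Unary.Linked using (Linked)
open import Data.List.Sort using (sort)
open import Data.Nat.Base using (ℕ; zero; suc; pred; NonZero; _≥_)
import Data.Nat.Base as ℕ
open import Data.Nat.Properties using (≤-decTotalOrder; _≟_)
open import Data.Product.Base using (∃-syntax; Σ-syntax)
open import Data.Rational.Base using (ℚ; 0ℚ; _+_; _-_; _/_)
open import Data.Sum.Base using (_⊎_)
open import Relation.Binary.Properties.DecTotalOrder ≤-decTotalOrder using (≥-decTotalOrder)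
open import Relation.Binary.PropositionalEquality.Core using (_≡_)
open import Relation.Nullary.Decidable using (_⊎-dec_; ¬?)
open import Relation.Unary using (Decidable)

record SimpleGraph (n : ℕ) : Set where
  field
    neighbours  : Fin n → Subset n
    symmetric   : ∀ {u v} → v ∈ neighbours u → u ∈ neighbours v
    irreflexive : ∀ {v} → v ∉ neighbours v

  degree : Fin n → ℕ
  degree v = ∣ neighbours v ∣

  degrees : List ℕ
  degrees = tabulate degree

Graphic : List ℕ → Set
Graphic d = ∃[ n ] Σ[ G ∈ SimpleGraph n ] SimpleGraph.degrees G ↭ d

Nonincreasing : List ℕ → Set
Nonincreasing = Linked _≥_

-- D ◂ ds is the step taken from the sequence D ∷ ds, whose largest term
-- D is positive.
record Step : Set where
  constructor _◂_
  field
    pivot        : ℕ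
    {{pivot≢0}}  : NonZero pivot
    others       : List ℕ

selected : Step → List ℕ
selected (D ◂ ds) = take D ds

-- On graphic sequences D is at most the length of ds and the selected
-- entries are positive, so neither take nor pred truncates.
reduce : Step → List ℕ
reduce (D ◂ ds) = sort ≥-decTotalOrder (map pred (take D ds) ++ drop D ds)

-- The first argument bounds the number of steps.  A step shortens the
-- sequence by one, so the length of the sequence is a sufficient bound.
stepsWithin : ℕ → List ℕ → List Step
stepsWithin zero    _            = []
stepsWithin (suc n) []           = []
stepsWithin (suc n) (zero  ∷ ds) = []
stepsWithin (suc n) (suc k ∷ ds) = (suc k ◂ ds) ∷ stepsWithin n (reduce (suc k ◂ ds))

-- The steps of the Havel–Hakimi trajectory, provided d is nonincreasing.
steps : List ℕ → List Step
steps d = stepsWithin (length d) d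

sumℚ : List ℚ → ℚ
sumℚ = foldr _+_ 0ℚ

-- The value at 0 is a convention; it is not used on graphic sequences.
recip : ℕ → ℚ
recip zero    = 0ℚ
recip (suc n) = + 1 / suc n

defect : Step → ℚ
defect s@(D ◂ _) = sumℚ (map (λ x → recip (x ℕ.* suc x)) (selected s)) - + 1 / suc D

totalDefect : List Step → ℚ
totalDefect ss = sumℚ (map defect ss)

InBand : ℕ → ℕ → Set
InBand D x = x ≡ D ⊎ x ≡ pred D

UnitBand : Step → Set
UnitBand s = All (InBand (Step.pivot s)) (selected s)

unitBand? : Decidable UnitBand
unitBand? (D ◂ ds) = all? (λ x → (x ≟ D) ⊎-dec (x ≟ pred D)) (take D ds)

unitBandSuffix : List ℕ → List Step
unitBandSuffix d = dropWhile (λ s → ¬? (unitBand? s)) (steps d)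

{-# OPTIONS --safe #-}

-- Write F(D) = 3/2 − 1/D − 1/(D+1), with F(0) = 0.  After a unit-band step
-- with pivot D, the next pivot D′ is at most D, and the D′ entries after it
-- are again at least D′ − 1.  If D′ = D then all selected entries were equal
-- to D and the defect is 0.  If D′ < D then the defect is at most
-- D · 1/((D−1)D) − 1/(D+1) = F(D) − F(D−1), or at most 0 = F(1) − F(0) if
-- D = 1.  Hence the defects telescope to at most F(D).
module Submission where

open import Defs
open import Data.Integer.Base using (+_; +≤+)
import Data.Integer.Base as ℤ
import Data.Integer.Properties as ℤ
open import Data.List.Base using (List; []; _∷_; _++_; map; take; drop; length; takeWhile)
open import Data.List.Membership.Propositional using (_∈_)
open import Data.List.Membership.Propositional.Properties using (∈-∃++; ∈-++⁻; ∈-map⁻)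
open import Data.List.Properties using (length-take; ∷-injectiveʳ; takeWhile++dropWhile)
open import Data.List.Relation.Binary.Permutation.Propositional using (_↭_; ↭-trans)
open import Data.List.Relation.Binary.Permutation.Propositional.Properties
  using (All-resp-↭; ∈-resp-↭; drop-∷; shift)
open import Data.List.Relation.Unary.All as All using (All; []; _∷_)
open import Data.List.Relation.Unary.All.Properties using (take⁺; drop⁺; all-head-dropWhile)
open import Data.List.Relation.Unary.Any using (here)
import Data.List.Relation.Unary.Linked as Linked
open import Data.List.Relation.Unary.Linked.Properties using (Linked⇒All)
open import Data.List.Sort using (sort-↭; sort-↗)
open import Data.Maybe.Relation.Unary.All using (just)
open import Data.Nat.Base using (ℕ; zero; suc; pred; NonZero; z≤n; s≤s; _≥_)
import Data.Nat.Base as ℕ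
import Data.Nat.Properties as ℕ
open import Data.Product.Base using (_×_; _,_)
open import Data.Rational.Base using (ℚ; 0ℚ; _+_; _-_; -_; _/_; _≤_; _<_; toℚᵘ)
import Data.Rational.Properties as ℚ
open import Data.Rational.Solver using (module +-*-Solver)
open import Data.Rational.Unnormalised.Base using (mkℚᵘ; *≤*; *≡*)
import Data.Rational.Unnormalised.Base as ℚᵘ
import Data.Rational.Unnormalised.Properties as ℚᵘ
open import Data.Sum.Base using (_⊎_; inj₁; inj₂)
open import Level using (0ℓ)
open import Relation.Binary.Properties.DecTotalOrder ℕ.≤-decTotalOrder using (≥-decTotalOrder)
open import Relation.Binary.PropositionalEquality.Core using (_≡_; refl; sym; trans; cong; subst)
open import Relation.Nullary.Decidable using (¬?; decidable-stable)
open import Relation.Unary using (Pred)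

-- Comparing and adding fractions of natural numbers.

/-mono-≤ : ∀ a b c d .{{_ : NonZero b}} .{{_ : NonZero d}} →
  a ℕ.* d ℕ.≤ c ℕ.* b → + a / b ≤ + c / d
-- Unnormalised rationals avoid the reduction to lowest terms in `_/_`, so that only
-- cross-multiplication is left.
/-mono-≤ a (suc b) c (suc d) ad≤cb = ℚ.toℚᵘ-cancel-≤ (begin
  toℚᵘ (+ a / suc b)  ≃⟨ ℚ.toℚᵘ-fromℚᵘ (mkℚᵘ (+ a) b) ⟩
  mkℚᵘ (+ a) b        ≤⟨ *≤* cross ⟩
  mkℚᵘ (+ c) d        ≃⟨ ℚ.toℚᵘ-fromℚᵘ (mkℚᵘ (+ c) d) ⟨
  toℚᵘ (+ c / suc d)  ∎)
  where
  open ℚᵘ.≤-Reasoning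
  cross : + a ℤ.* + suc d ℤ.≤ + c ℤ.* + suc b
  cross rewrite sym (ℤ.pos-* a (suc d)) | sym (ℤ.pos-* c (suc b)) = +≤+ ad≤cb

/-distribʳ-+ : ∀ a b c .{{_ : NonZero c}} → + a / c + + b / c ≡ + (a ℕ.+ b) / c
/-distribʳ-+ a b (suc c) = ℚ.toℚᵘ-injective (begin-equality
  toℚᵘ (+ a / suc c + + b / suc c)            ≃⟨ ℚ.toℚᵘ-homo-+ (+ a / suc c) (+ b / suc c) ⟩
  toℚᵘ (+ a / suc c) ℚᵘ.+ toℚᵘ (+ b / suc c)  ≃⟨ ℚᵘ.+-cong (ℚ.toℚᵘ-fromℚᵘ (mkℚᵘ (+ a) c)) (ℚ.toℚᵘ-fromℚᵘ (mkℚᵘ (+ b) c)) ⟩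
  mkℚᵘ (+ a) c ℚᵘ.+ mkℚᵘ (+ b) c              ≃⟨ *≡* cross ⟩
  mkℚᵘ (+ (a ℕ.+ b)) c                        ≃⟨ ℚ.toℚᵘ-fromℚᵘ (mkℚᵘ (+ (a ℕ.+ b)) c) ⟨
  toℚᵘ (+ (a ℕ.+ b) / suc c)                  ∎)
  where
  open ℚᵘ.≤-Reasoning
  C = + suc c
  cross : (+ a ℤ.* C ℤ.+ + b ℤ.* C) ℤ.* C ≡ + (a ℕ.+ b) ℤ.* (C ℤ.* C)
  cross = trans (cong (ℤ._* C) (sym (ℤ.*-distribʳ-+ C (+ a) (+ b)))) (ℤ.*-assoc (+ (a ℕ.+ b)) C C)

0≤/ : ∀ a b .{{_ : NonZero b}} → 0ℚ ≤ + a / b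
0≤/ a b = ℚ.nonNegative⁻¹ (+ a / b) {{ℚ.normalize-nonNeg a b}}

1/-antimono-≤ : ∀ m n .{{_ : NonZero m}} .{{_ : NonZero n}} → m ℕ.≤ n → + 1 / n ≤ + 1 / m
1/-antimono-≤ m n m≤n = /-mono-≤ 1 n 1 m (ℕ.*-monoʳ-≤ 1 m≤n)

-- Missing terms count as copies of 1/c, which only enlarge the bound; so `take D ds` may have fewer
-- than D entries.
sumℚ≤length/c : ∀ {A : Set} (f : A → ℚ) c .{{_ : NonZero c}} {xs} n →
  All (λ x → f x ≤ + 1 / c) xs → length xs ℕ.≤ n → sumℚ (map f xs) ≤ + n / c
sumℚ≤length/c f c n       []         _           = 0≤/ n c
sumℚ≤length/c f c (suc n) (px ∷ pxs) (s≤s len≤n) =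
  ℚ.≤-trans (ℚ.+-mono-≤ px (sumℚ≤length/c f c n pxs len≤n)) (ℚ.≤-reflexive (/-distribʳ-+ 1 n c))

0≤q⇒p-q≤p : ∀ p {q} → 0ℚ ≤ q → p - q ≤ p
0≤q⇒p-q≤p p 0≤q =
  ℚ.≤-trans (ℚ.+-monoʳ-≤ p (ℚ.neg-antimono-≤ 0≤q)) (ℚ.≤-reflexive (ℚ.+-identityʳ p))

p≤q⇒p-q≤0 : ∀ {p q} → p ≤ q → p - q ≤ 0ℚ
p≤q⇒p-q≤0 {p} {q} p≤q = ℚ.≤-trans (ℚ.+-monoˡ-≤ (- q) p≤q) (ℚ.≤-reflexive (ℚ.+-inverseʳ q))

-- The bound F and the defect of a single step.

bandBound : ℕ → ℚ
bandBound zero    = 0ℚ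
bandBound (suc k) = + 3 / 2 - + 1 / suc k - + 1 / suc (suc k)

bandBound-mono-≤ : ∀ {m n} → m ℕ.≤ n → bandBound m ≤ bandBound n
bandBound-mono-≤ {n = zero}  z≤n = ℚ.≤-refl
-- F(1) = 3/2 - 1 - 1/2 evaluates to 0 = F(0), so the comparison may start from 1.
bandBound-mono-≤ {n = suc n} z≤n = bandBound-mono-≤ {1} {suc n} (s≤s z≤n)
bandBound-mono-≤ {suc m} {suc n} m≤n@(s≤s _) =
  ℚ.+-mono-≤ (ℚ.+-monoʳ-≤ (+ 3 / 2) (ℚ.neg-antimono-≤ (1/-antimono-≤ (suc m) (suc n) m≤n)))
             (ℚ.neg-antimono-≤ (1/-antimono-≤ (suc (suc m)) (suc (suc n)) (s≤s m≤n)))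

0≤bandBound : ∀ n → 0ℚ ≤ bandBound n
0≤bandBound n = bandBound-mono-≤ {0} {n} z≤n

bandBound<3/2 : ∀ n → bandBound n < + 3 / 2
bandBound<3/2 zero    = ℚ.positive⁻¹ (+ 3 / 2)
bandBound<3/2 (suc k) = ℚ.≤-<-trans
  (0≤q⇒p-q≤p (+ 3 / 2 - + 1 / suc k) (0≤/ 1 (suc (suc k))))
  (ℚ.<-≤-trans
    (ℚ.+-monoʳ-< (+ 3 / 2)
      (ℚ.neg-antimono-< (ℚ.positive⁻¹ (+ 1 / suc k) {{ℚ.normalize-pos 1 (suc k)}})))
    (ℚ.≤-reflexive (ℚ.+-identityʳ (+ 3 / 2))))

recip-antimono-≤ : ∀ {m n} → 0 ℕ.< m → m ℕ.≤ n → recip n ≤ recip m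
recip-antimono-≤ {suc m} {suc n} _ m≤n = 1/-antimono-≤ (suc m) (suc n) m≤n

recip-pronic≤ : ∀ m {x} → suc m ℕ.≤ x → recip (x ℕ.* suc x) ≤ + 1 / (suc m ℕ.* suc (suc m))
recip-pronic≤ m m<x = recip-antimono-≤ (s≤s z≤n) (ℕ.*-mono-≤ m<x (s≤s m<x))

-- For pivot 1 the band contains 0, where `recip` takes its conventional value 0; the bound covers
-- that case too.
recip-pronic≤1/2 : ∀ x → recip (x ℕ.* suc x) ≤ + 1 / 2
recip-pronic≤1/2 zero    = 0≤/ 1 2
recip-pronic≤1/2 (suc x) = recip-pronic≤ 0 {suc x} (s≤s z≤n)

-- The sum has at most D terms. The values used for c are D(D+1), (D-1)D and, for pivot 1, 2.
defect≤ : ∀ D c {{_ : NonZero D}} .{{_ : NonZero c}} {ds} →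
  All (λ x → recip (x ℕ.* suc x) ≤ + 1 / c) (take D ds) →
  defect (D ◂ ds) ≤ + D / c - + 1 / suc D
defect≤ D c {ds = ds} small = ℚ.+-monoˡ-≤ (- (+ 1 / suc D))
  (sumℚ≤length/c (λ x → recip (x ℕ.* suc x)) c D small
    (subst (ℕ._≤ D) (sym (length-take D ds)) (ℕ.m⊓n≤m D (length ds))))

-- At most D terms, each at most 1/(D(D+1)), sum to at most the subtracted 1/(D+1).
defect≤0 : ∀ k {ds} → All (suc k ℕ.≤_) (take (suc k) ds) → defect (suc k ◂ ds) ≤ 0ℚ
defect≤0 k {ds} large = ℚ.≤-trans
  (defect≤ (suc k) (suc k ℕ.* suc (suc k)) {ds = ds} (All.map (recip-pronic≤ k) large))
  (p≤q⇒p-q≤0 (/-mono-≤ (suc k) (suc k ℕ.* suc (suc k)) 1 (suc (suc k))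
    (ℕ.≤-reflexive (sym (ℕ.*-identityˡ (suc k ℕ.* suc (suc k)))))))

defect+bandBound≤bandBound : ∀ k {ds} → All (k ℕ.≤_) (take (suc k) ds) →
  defect (suc k ◂ ds) + bandBound k ≤ bandBound (suc k)
defect+bandBound≤bandBound zero {ds} _ =
  -- The bound 1/2 - 1/2 evaluates to 0, as do F(0) and F(1).
  ℚ.+-monoˡ-≤ 0ℚ (defect≤ 1 2 {ds = ds} (All.universal recip-pronic≤1/2 (take 1 ds)))
defect+bandBound≤bandBound (suc j) {ds} large = begin
  -- With D = j + 2, the letters a, b, c are 1/(D-1), 1/D, 1/(D+1). The defect is at most a - c, and
  -- a cancels against F(D-1).
  defect (suc (suc j) ◂ ds) + (t - a - b)  ≤⟨ ℚ.+-monoˡ-≤ (t - a - b) (ℚ.≤-trans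
    (defect≤ (suc (suc j)) (suc j ℕ.* suc (suc j)) {ds = ds} (All.map (recip-pronic≤ j) large))
    (ℚ.+-monoˡ-≤ (- c) D/[[D-1]*D]≤a)) ⟩
  a - c + (t - a - b)                      ≡⟨ solve 4
    (λ t a b c → (a :- c) :+ ((t :- a) :- b) := (t :- b) :- c) refl t a b c ⟩
  t - b - c                                ∎
  where
  open ℚ.≤-Reasoning
  open +-*-Solver
  t = + 3 / 2
  a = + 1 / suc j
  b = + 1 / suc (suc j)
  c = + 1 / suc (suc (suc j))
  D/[[D-1]*D]≤a : + suc (suc j) / (suc j ℕ.* suc (suc j)) ≤ a
  D/[[D-1]*D]≤a = /-mono-≤ (suc (suc j)) (suc j ℕ.* suc (suc j)) 1 (suc j)
    (ℕ.≤-reflexive (trans (ℕ.*-comm (suc (suc j)) (suc j)) (sym (ℕ.*-identityˡ _))))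

-- Lower bounds on prefixes, and sorting.

All-take-drop-mid : ∀ {A : Set} {P : Pred A 0ℓ} k us {v : A} {vs} →
  All P (take (suc k) (us ++ v ∷ vs)) → All P (take k (us ++ vs))
All-take-drop-mid k       []       (_ ∷ pvs)  = pvs
All-take-drop-mid zero    (u ∷ us) _          = []
All-take-drop-mid (suc k) (u ∷ us) (pu ∷ pus) = pu ∷ All-take-drop-mid k us pus

All-take-≤ : ∀ {A : Set} {P : Pred A 0ℓ} {j k} (xs : List A) → j ℕ.≤ k →
  All P (take k xs) → All P (take j xs)
All-take-≤ _        z≤n       _          = []
All-take-≤ []       (s≤s j≤k) _          = []
All-take-≤ (x ∷ xs) (s≤s j≤k) (px ∷ pxs) = px ∷ All-take-≤ xs j≤k pxs

head-≥ : ∀ {x xs} → Nonincreasing (x ∷ xs) → All (x ≥_) (x ∷ xs)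
head-≥ = Linked⇒All (λ j≤i k≤j → ℕ.≤-trans k≤j j≤i) ℕ.≤-refl

-- Sorting in nonincreasing order moves large entries forward. The head of `xs` is the maximum of
-- `ws`, so it dominates the first entry of `ws`; deleting its copy from `ws` costs the bounded
-- prefix at most one place.
All-take-sorted : ∀ {m} k {xs ws} → Nonincreasing xs → xs ↭ ws →
  All (m ℕ.≤_) (take k ws) → All (m ℕ.≤_) (take k xs)
All-take-sorted zero    _ _ _ = []
All-take-sorted (suc k) {[]} _ _ _ = []
All-take-sorted {m} (suc k) {x ∷ xs} {ws} x∷xs↘ x∷xs↭ws large =
  m≤max x∈ws (All-resp-↭ x∷xs↭ws (head-≥ x∷xs↘)) large ∷ rest
  where
  x∈ws : x ∈ ws
  x∈ws = ∈-resp-↭ x∷xs↭ws (here refl)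

  m≤max : ∀ {ws} → x ∈ ws → All (x ≥_) ws → All (m ℕ.≤_) (take (suc k) ws) → m ℕ.≤ x
  m≤max {_ ∷ _} _ (w≤x ∷ _) (m≤w ∷ _) = ℕ.≤-trans m≤w w≤x

  rest : All (m ℕ.≤_) (take k xs)
  rest with us , vs , refl ← ∈-∃++ x∈ws =
    All-take-sorted k (Linked.tail x∷xs↘) (drop-∷ (↭-trans x∷xs↭ws (shift x us vs)))
      (All-take-drop-mid k us large)

-- `v` stands at position k or later, counting from 0, so each of the positions 0 to k comes no
-- later than `v`.
∈-drop⇒All-take : ∀ {v} k {xs} → Nonincreasing xs → v ∈ drop k xs → All (v ℕ.≤_) (take (suc k) xs)
∈-drop⇒All-take zero    {x ∷ xs}     xs↘ v∈ = All.lookup (head-≥ xs↘) v∈ ∷ []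
∈-drop⇒All-take (suc k) {x ∷ y ∷ xs} (y≤x Linked.∷ xs↘) v∈
  with v≤y ∷ large ← ∈-drop⇒All-take k xs↘ v∈ = ℕ.≤-trans v≤y y≤x ∷ v≤y ∷ large
∈-drop⇒All-take (suc zero)    {_ ∷ []} _ ()
∈-drop⇒All-take (suc (suc k)) {_ ∷ []} _ ()

-- One reduction step, before and after reordering.

lowered : ℕ → List ℕ → List ℕ
lowered k xs = map pred (take k xs) ++ drop k xs

-- No entry falls by more than one. The prefix length j is independent of k because a prefix
-- reaching one entry past the selected ones is also considered.
lowered-≥ : ∀ {m} j k xs → All (m ℕ.≤_) (take j xs) → All (pred m ℕ.≤_) (take j (lowered k xs))
lowered-≥ zero    k       xs       _             = []
lowered-≥ (suc j) zero    []       _             = []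
lowered-≥ (suc j) (suc k) []       _             = []
lowered-≥ (suc j) zero    (x ∷ xs) (m≤x ∷ large) =
  ℕ.≤-trans ℕ.pred[n]≤n m≤x ∷ lowered-≥ j zero xs large
lowered-≥ (suc j) (suc k) (x ∷ xs) (m≤x ∷ large) = ℕ.pred-mono-≤ m≤x ∷ lowered-≥ j k xs large

reduce-↘ : ∀ s → Nonincreasing (reduce s)
reduce-↘ (D ◂ ds) = sort-↗ ≥-decTotalOrder (lowered D ds)

reduce-↭ : ∀ s → reduce s ↭ lowered (Step.pivot s) (Step.others s)
reduce-↭ (D ◂ ds) = sort-↭ ≥-decTotalOrder (lowered D ds)

module _ {k ds D′ ds′} (↘ : Nonincreasing (suc k ∷ ds))
         (eq : reduce (suc k ◂ ds) ≡ D′ ∷ ds′) where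

  private
    ↭lowered : D′ ∷ ds′ ↭ lowered (suc k) ds
    ↭lowered = subst (_↭ lowered (suc k) ds) eq (reduce-↭ (suc k ◂ ds))

    ds≤D : All (ℕ._≤ suc k) ds
    ds≤D = All.tail (head-≥ ↘)

  -- An entry D remaining after the step was not selected, so sortedness
  -- forces every selected entry to be D.
  reduced-pivot : D′ ℕ.≤ k ⊎ D′ ≡ suc k × All (suc k ℕ.≤_) (take (suc (suc k)) ds)
  reduced-pivot with ∈-++⁻ (map pred (take (suc k) ds)) (∈-resp-↭ ↭lowered (here refl))
  ... | inj₁ D′∈sel with y , y∈sel , refl ← ∈-map⁻ pred D′∈sel =
    inj₁ (ℕ.pred-mono-≤ (All.lookup (take⁺ (suc k) ds≤D) y∈sel))
  ... | inj₂ D′∈rest with ℕ.m≤n⇒m<n∨m≡n (All.lookup (drop⁺ (suc k) ds≤D) D′∈rest)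
  ...   | inj₁ (s≤s D′≤k) = inj₁ D′≤k
  ...   | inj₂ refl       = inj₂ (refl , ∈-drop⇒All-take (suc k) (Linked.tail ↘) D′∈rest)

  -- The invariant of the telescoping: the lower half of the band condition, the upper half being
  -- sortedness. The new pivot and its D′ selected entries call for a bound on D′ + 1 lowered
  -- entries. If D′ < D, these are among the first D; if D′ = D, `reduced-pivot` supplies the one
  -- entry beyond the selected ones.
  reduced-band : All (k ℕ.≤_) (take (suc k) ds) → All (pred D′ ℕ.≤_) (take D′ ds′)
  reduced-band large = All.tail (All-take-sorted (suc D′)
    (subst Nonincreasing eq (reduce-↘ (suc k ◂ ds))) ↭lowered (leading reduced-pivot))
    where
    leading : D′ ℕ.≤ k ⊎ D′ ≡ suc k × All (suc k ℕ.≤_) (take (suc (suc k)) ds) →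
      All (pred D′ ℕ.≤_) (take (suc D′) (lowered (suc k) ds))
    leading (inj₁ D′≤k) = All-take-≤ (lowered (suc k) ds) (s≤s D′≤k)
      (All.map (ℕ.≤-trans (ℕ.pred-mono-≤ D′≤k)) (lowered-≥ (suc k) (suc k) ds large))
    leading (inj₂ (refl , full)) = lowered-≥ (suc (suc k)) (suc k) ds full

-- Telescoping along the trajectory.

totalDefect≤bandBound : ∀ n {D ds} → Nonincreasing (D ∷ ds) → All (pred D ℕ.≤_) (take D ds) →
  totalDefect (stepsWithin n (D ∷ ds)) ≤ bandBound D
totalDefect≤bandBound zero    {D}          _ _ = 0≤bandBound D
totalDefect≤bandBound (suc n) {zero}       _ _ = ℚ.≤-refl
totalDefect≤bandBound (suc n) {suc k} {ds} ↘ large with reduce (suc k ◂ ds) in eq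
... | [] = ℚ.≤-trans
  (ℚ.+-monoʳ-≤ (defect (suc k ◂ ds)) (ℚ.≤-trans (ℚ.≤-reflexive (none n)) (0≤bandBound k)))
  (defect+bandBound≤bandBound k large)
  where
  none : ∀ n → totalDefect (stepsWithin n []) ≡ 0ℚ
  none zero    = refl
  none (suc n) = refl
... | D′ ∷ ds′
  with ih ← totalDefect≤bandBound n
              (subst Nonincreasing eq (reduce-↘ (suc k ◂ ds))) (reduced-band ↘ eq large)
  with reduced-pivot ↘ eq
-- The pivot drops, possibly by more than one: monotonicity raises F(D′) to F(D-1), and the one-step
-- inequality leads to F(D).
...   | inj₁ D′≤k = ℚ.≤-trans
  (ℚ.+-monoʳ-≤ (defect (suc k ◂ ds)) (ℚ.≤-trans ih (bandBound-mono-≤ D′≤k)))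
  (defect+bandBound≤bandBound k large)
-- The pivot stays, so the defect is at most 0 and F(D) carries over.
...   | inj₂ (refl , full) = ℚ.≤-trans
  (ℚ.+-mono-≤ (defect≤0 k (All-take-≤ ds (ℕ.n≤1+n (suc k)) full)) ih)
  (ℚ.≤-reflexive (ℚ.+-identityˡ (bandBound (suc k))))

InBand⇒≥pred : ∀ {D x} → InBand D x → pred D ℕ.≤ x
InBand⇒≥pred (inj₁ refl) = ℕ.pred[n]≤n
InBand⇒≥pred (inj₂ refl) = ℕ.≤-refl

-- A unit-band step anywhere in the trajectory starts the invariant. Induction on `ps` walks to that
-- step, each reduction being sorted again.
suffix-bound : ∀ n {d} → Nonincreasing d → ∀ ps {s ss} → stepsWithin n d ≡ ps ++ s ∷ ss →
  UnitBand s → totalDefect (s ∷ ss) ≤ bandBound (Step.pivot s)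
suffix-bound (suc n) {suc k ∷ ds} ↘ []       refl band =
  totalDefect≤bandBound (suc n) ↘ (All.map InBand⇒≥pred band)
suffix-bound (suc n) {suc k ∷ ds} ↘ (p ∷ ps) eq   band =
  suffix-bound n (reduce-↘ (suc k ◂ ds)) ps (∷-injectiveʳ eq) band
suffix-bound zero                 ↘ []       ()   band
suffix-bound zero                 ↘ (p ∷ ps) ()   band
suffix-bound (suc n) {[]}         ↘ []       ()   band
suffix-bound (suc n) {[]}         ↘ (p ∷ ps) ()   band
suffix-bound (suc n) {zero ∷ ds}  ↘ []       ()   band
suffix-bound (suc n) {zero ∷ ds}  ↘ (p ∷ ps) ()   band

-- The head left by `dropWhile` fails the negated test, and decidability turns this into `UnitBand`.
unitBandSuffix-bound : ∀ {d} → Nonincreasing d → ∀ {s ss} → unitBandSuffix d ≡ s ∷ ss →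
  totalDefect (s ∷ ss) ≤ bandBound (Step.pivot s)
unitBandSuffix-bound {d} ↘ eq
  with takeWhile++dropWhile (λ s → ¬? (unitBand? s)) (steps d)
     | all-head-dropWhile (λ s → ¬? (unitBand? s)) (steps d)
... | split | first rewrite eq with just {s} ¬¬band ← first =
  suffix-bound (length d) ↘ (takeWhile (λ s → ¬? (unitBand? s)) (steps d)) (sym split)
    (decidable-stable (unitBand? s) ¬¬band)

theorem11 : ∀ (d : List ℕ) → Nonincreasing d → Graphic d →
    (∀ (D : ℕ) {{_ : NonZero D}} (ds : List ℕ) (ss : List Step) →
    unitBandSuffix d ≡ (D ◂ ds) ∷ ss →
    totalDefect (unitBandSuffix d) ≤ + 3 / 2 - + 1 / D - + 1 / suc D ×
    + 3 / 2 - + 1 / D - + 1 / suc D < + 3 / 2) ×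
    (unitBandSuffix d ≡ [] → totalDefect (unitBandSuffix d) ≡ 0ℚ) ×
    totalDefect (unitBandSuffix d) ≤ + 3 / 2 ×
    (∀ (ps ss : List Step) → steps d ≡ ps ++ ss → All UnitBand ss →
    totalDefect ss ≤ + 3 / 2)
theorem11 d ↘ _ = nonempty , cong totalDefect , total , anySuffix
  where
  nonempty : ∀ (D : ℕ) {{_ : NonZero D}} (ds : List ℕ) (ss : List Step) →
    unitBandSuffix d ≡ (D ◂ ds) ∷ ss →
    totalDefect (unitBandSuffix d) ≤ + 3 / 2 - + 1 / D - + 1 / suc D ×
    + 3 / 2 - + 1 / D - + 1 / suc D < + 3 / 2
  -- Once D is `suc k`, the stated expression is `bandBound (suc k)` by definition.
  nonempty (suc k) ds ss eq =
    subst (λ ss → totalDefect ss ≤ bandBound (suc k)) (sym eq) (unitBandSuffix-bound ↘ eq) ,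
    bandBound<3/2 (suc k)

  total : totalDefect (unitBandSuffix d) ≤ + 3 / 2
  total with unitBandSuffix d in eq
  ... | []     = 0≤/ 3 2
  ... | s ∷ ss = ℚ.≤-trans (unitBandSuffix-bound ↘ eq) (ℚ.<⇒≤ (bandBound<3/2 (Step.pivot s)))

  anySuffix : ∀ (ps ss : List Step) → steps d ≡ ps ++ ss → All UnitBand ss → totalDefect ss ≤ + 3 / 2
  anySuffix ps []       _  _          = 0≤/ 3 2
  anySuffix ps (s ∷ ss) eq (band ∷ _) =
    ℚ.≤-trans (suffix-bound (length d) ↘ ps eq band) (ℚ.<⇒≤ (bandBound<3/2 (Step.pivot s)))
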